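{- Let $G=(A,B,E)$ be a bipartite graph with $n=|A|$ and $m=|B|$, whose edge set is partitioned as $E=E_1\cup E_2$ with $E_1$ given to Alice and $E_2$ given to Bob. Then there are one-way two-party deterministic communication protocols (Alice sends one message to Bob, who outputs a semi-matching of $G$) for the semi-matching problem, one with (1) message size $c\,n\log m$ and approximation factor $n^{1/2}+2$, and another one with (2) message size $2c\,n\log m$ and approximation factor $2n^{1/3}+2$, where $c$ is a constant. Here a protocol has approximation factor $\beta$ if the output semi-matching $S$ satisfies $\operatorname{deg}_{\max} S\le\beta\cdot\operatorname{deg}_{\max}S^*$, $S^*$ an optimal semi-matching of $G$.
   Context: For $E'\subseteq E$, $\deg_{E'}(v)$ is the number of edges of $E'$ at $v$ and $\operatorname{deg}_{\max}E'=\max_{v\in A\cup B}\deg_{E'}(v)$. A semi-matching of $G$ is a set $S\subseteq E$ with $\deg_S(a)=1$ for all $a\in A$ (it is assumed $G$ has one). A degree-minimizing path with respect to $S$ is a path $b_1,a_1,b_2,\dots,a_{k-1},b_k$ ($k\ge2$) with $(a_i,b_i)\in S$, $(a_i,b_{i+1})\in E\setminus S$, $\deg_S(b_1)\ge\deg_S(b_k)+2$; an optimal semi-matching is one admitting no degree-minimizing path, and all optimal semi-matchings have the same (minimum possible) maximum degree. Message size is measured in bits. -}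

module Defs where

open import Data.Nat using (ℕ; zero; suc; _+_; _*_; _∸_; _^_; _≤_; _⊔_)
open import Data.Nat.Logarithm using (⌈log₂_⌉)
open import Data.Bool using (Bool; true; false; if_then_else_; _∨_)
open import Data.Fin using (Fin; inject₁; fromℕ)
import Data.Fin as F
open import Data.List using (List; length)
open import Data.Product using (Σ; ∃; _×_; _,_)
open import Relation.Binary.PropositionalEquality using (_≡_)
open import Relation.Nullary using (¬_)
open import Function.Definitions using (Injective)

-- A bipartite graph G = (A, B, E) with A = Fin n, B = Fin m;
-- an edge set is given by its characteristic function on A × B.
EdgeSet : ℕ → ℕ → Set
EdgeSet n m = Fin n → Fin m → Bool

_∪E_ : ∀ {n m} → EdgeSet n m → EdgeSet n m → EdgeSet n m
(E₁ ∪E E₂) a b = E₁ a b ∨ E₂ a b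

_⊆E_ : ∀ {n m} → EdgeSet n m → EdgeSet n m → Set
S ⊆E E = ∀ a b → S a b ≡ true → E a b ≡ true

Disjoint : ∀ {n m} → EdgeSet n m → EdgeSet n m → Set
Disjoint E₁ E₂ = ∀ a b → E₁ a b ≡ true → E₂ a b ≡ false

count : ∀ {k} → (Fin k → Bool) → ℕ
count {zero}  f = 0
count {suc k} f = (if f F.zero then 1 else 0) + count (λ i → f (F.suc i))

maxOver : ∀ {k} → (Fin k → ℕ) → ℕ
maxOver {zero}  f = 0
maxOver {suc k} f = f F.zero ⊔ maxOver (λ i → f (F.suc i))

degA : ∀ {n m} → EdgeSet n m → Fin n → ℕ
degA S a = count (λ b → S a b)

degB : ∀ {n m} → EdgeSet n m → Fin m → ℕ
degB S b = count (λ a → S a b)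

degMax : ∀ {n m} → EdgeSet n m → ℕ
degMax S = maxOver (degA S) ⊔ maxOver (degB S)

IsSemiMatching : ∀ {n m} → EdgeSet n m → EdgeSet n m → Set
IsSemiMatching E S = S ⊆E E × (∀ a → degA S a ≡ 1)

HasSemiMatching : ∀ {n m} → EdgeSet n m → Set
HasSemiMatching E = ∃ λ S → IsSemiMatching E S

-- A degree-minimizing path w.r.t. S: b₁,a₁,b₂,…,a_{k-1},b_k with k = suc k' ≥ 2,
-- (a_i,b_i) ∈ S, (a_i,b_{i+1}) ∈ E ∖ S, deg_S(b₁) ≥ deg_S(b_k) + 2,
-- with pairwise distinct vertices (it is a path).
record DegMinPath {n m} (E S : EdgeSet n m) : Set where
  field
    k'    : ℕ
    k'≥1  : 1 ≤ k'
    bs    : Fin (suc k') → Fin m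
    as    : Fin k' → Fin n
    bs-inj : Injective _≡_ _≡_ bs
    as-inj : Injective _≡_ _≡_ as
    inS   : ∀ i → S (as i) (bs (inject₁ i)) ≡ true
    inE   : ∀ i → E (as i) (bs (F.suc i)) ≡ true
    notS  : ∀ i → S (as i) (bs (F.suc i)) ≡ false
    degGap : degB S (bs (fromℕ k')) + 2 ≤ degB S (bs F.zero)

IsOptimalSemiMatching : ∀ {n m} → EdgeSet n m → EdgeSet n m → Set
IsOptimalSemiMatching E S = IsSemiMatching E S × ¬ DegMinPath E S

-- d ≤ (n^{1/2} + 2)·d*   ⇔   (d ∸ 2d*)² ≤ n·d*²   (exact, over ℕ)
WithinSqrtFactor : ℕ → ℕ → ℕ → Set
WithinSqrtFactor n d d* = (d ∸ 2 * d*) ^ 2 ≤ n * d* ^ 2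

-- d ≤ (2·n^{1/3} + 2)·d*   ⇔   (d ∸ 2d*)³ ≤ 8·n·d*³   (exact, over ℕ)
WithinCbrtFactor : ℕ → ℕ → ℕ → Set
WithinCbrtFactor n d d* = (d ∸ 2 * d*) ^ 3 ≤ 8 * n * d* ^ 3

-- A one-way deterministic two-party protocol: for given vertex sets
-- A = Fin n, B = Fin m (known to both parties), Alice maps her edge set E₁
-- to a bit string; Bob maps the message and his edge set E₂ to an output.
record OneWayProtocol : Set where
  field
    message : (n m : ℕ) → EdgeSet n m → List Bool
    output  : (n m : ℕ) → List Bool → EdgeSet n m → EdgeSet n m

Solves : OneWayProtocol → (ℕ → ℕ → ℕ) → (ℕ → ℕ → ℕ → Set) → Set
Solves P size Approx =
  ∀ n m (E₁ E₂ : EdgeSet n m) → Disjoint E₁ E₂ → HasSemiMatching (E₁ ∪E E₂) →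
    let open OneWayProtocol P
        S = output n m (message n m E₁) E₂
    in length (message n m E₁) ≤ size n m
     × IsSemiMatching (E₁ ∪E E₂) S
     × (∀ S* → IsOptimalSemiMatching (E₁ ∪E E₂) S* →
          Approx n (degMax S) (degMax S*))

-- log m (base 2, rounded up; the constant c absorbs the base/rounding)
logCeil : ℕ → ℕ
logCeil m = ⌈log₂ m ⌉

{-# OPTIONS --safe #-}
module Submission where

-- Call an assignment A → B balanced if it minimises the sum of squared loads; shifting one
-- unit of load along an alternating path shows that the load at its start then exceeds
-- the load at its end by at most 1.
--
-- Alice sends a balanced assignment f in E₁ and, in the second protocol, also a balanced
-- assignment g of each fibre of f.  Bob takes a balanced assignment F in the union H of
-- what he received with E₂.  If the maximum load T of F is large, the set R of vertices
-- reachable from a vertex of load T has t elements of load at least T − 1, and the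
-- vertices assigned into R have all their H-neighbours in R.  Let φ be a semi-matching of
-- maximum load k.  At most kt of those vertices use an E₂-edge in φ; let X be the set of
-- the others, so |X| > (T − k − 1)t.  As f is balanced along the E₁-edges (a, φ a),
-- Σ_{a ∈ X} load(f a) ≤ kn + |X|, while f maps X into R, so |X|² ≤ t(kn + |X|) by
-- Cauchy–Schwarz.  With g, the same argument inside the fibre over v, where X has d
-- elements, gives d² ≤ t(k load(v) + d) ≤ 2tk load(v), whence Σ d³ ≤ 2tk(kn + |X|) ≤ 4tk²n.

open import Defs
open import Data.Bool using (Bool; true; false; if_then_else_; _∨_)
import Data.Bool.Properties as Bool
open import Data.Fin using (Fin; zero; suc; toℕ; inject≤; combine; quotient; remainder; finToFun; funToFin)
open import Data.Fin.Properties using (_≟_; all?; any?; finToFun-funToFin; funToFin-finToFin; inject≤-injective; remQuot-combine; combine-injective; combine-remQuot)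
open import Data.List using (List; []; _∷_; filter; allFin; length; tabulate)
open import Data.List.Membership.Propositional using (_∈_)
open import Data.List.Membership.Propositional.Properties using (∈-filter⁺; ∈-filter⁻; ∈-allFin)
open import Data.List.Properties using (length-tabulate)
import Data.List.Relation.Unary.All as All
open import Data.List.Relation.Unary.Any using (here; there)
open import Data.Nat using (ℕ; zero; suc; _+_; _*_; _∸_; _^_; _⊔_; _≤_; _<_; _≤?_; z≤n; s≤s; >-nonZero; ⌊_/2⌋; ⌈_/2⌉)
open import Data.Nat.Induction using (<-rec)
open import Data.Nat.Logarithm using (⌈log₂_⌉; ⌈log₂⌉-mono-≤; ⌈log₂⌈n/2⌉⌉≡⌈log₂n⌉∸1)
open import Data.Nat.Properties hiding (_≟_)
open import Data.Nat.Tactic.RingSolver using (solve-∀)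
open import Data.Product using (∃; Σ; _×_; _,_; proj₁; proj₂)
open import Data.Sum using (_⊎_; inj₁; inj₂; [_,_]′)
open import Function using (_∘_)
open import Relation.Binary.PropositionalEquality
open import Relation.Nullary using (¬_; Dec; yes; no; does; contradiction)
open import Relation.Nullary.Decidable using (_×-dec_; _⊎-dec_; dec-true; decidable-stable; ¬¬-excluded-middle)

open import Algebra.Properties.Semiring.Sum +-*-semiring using (sum; sum-cong-≗; ∑-distrib-+; ∑-comm; *-distribˡ-sum)
open import Data.List.Extrema ≤-totalOrder using (argmin; argmin-sel; f[argmin]≤f[⊤]; f[argmin]≤f[xs])

private variable
  n m p : ℕ

-- Sums over Fin

sum-mono-≤ : {f g : Fin n → ℕ} → (∀ i → f i ≤ g i) → sum f ≤ sum g
sum-mono-≤ {zero}  f≤g = z≤n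
sum-mono-≤ {suc n} f≤g = +-mono-≤ (f≤g zero) (sum-mono-≤ (f≤g ∘ suc))

⟦_⟧ : Bool → ℕ
⟦ b ⟧ = if b then 1 else 0

δ : Fin n → Fin n → ℕ
δ i j = ⟦ does (i ≟ j) ⟧

δ-refl : (i : Fin n) → δ i i ≡ 1
δ-refl zero    = refl
δ-refl (suc i) = δ-refl i

sum-0 : ∀ n → sum {n} (λ _ → 0) ≡ 0
sum-0 zero    = refl
sum-0 (suc n) = sum-0 n

sum-1 : ∀ n → sum {n} (λ _ → 1) ≡ n
sum-1 zero    = refl
sum-1 (suc n) = cong suc (sum-1 n)

sum-δ : (w : Fin n → ℕ) (i : Fin n) → sum (λ j → w j * δ i j) ≡ w i
sum-δ {suc n} w zero = begin
  w zero * 1 + sum (λ j → w (suc j) * 0)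
    ≡⟨ cong₂ _+_ (*-identityʳ _) (sum-cong-≗ (λ j → *-zeroʳ (w (suc j)))) ⟩
  w zero + sum {n} (λ _ → 0)              ≡⟨ cong (w zero +_) (sum-0 n) ⟩
  w zero + 0                              ≡⟨ +-identityʳ _ ⟩
  w zero                                  ∎
  where open ≡-Reasoning
sum-δ {suc n} w (suc i) = trans (cong (_+ sum (λ j → w (suc j) * δ i j)) (*-zeroʳ (w zero))) (sum-δ (w ∘ suc) i)

sum-δ-row : (i : Fin n) → sum (δ i) ≡ 1
sum-δ-row i = trans (sum-cong-≗ (λ j → sym (*-identityˡ (δ i j)))) (sum-δ (λ _ → 1) i)

term≤sum : (f : Fin n → ℕ) (i : Fin n) → f i ≤ sum f
term≤sum f zero    = m≤m+n _ _
term≤sum f (suc i) = ≤-trans (term≤sum (f ∘ suc) i) (m≤n+m _ _)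

count≡sum : (f : Fin n → Bool) → count f ≡ sum (λ i → ⟦ f i ⟧)
count≡sum {zero}  f = refl
count≡sum {suc n} f = cong (⟦ f zero ⟧ +_) (count≡sum (f ∘ suc))

-- Three weights `u` occur: the constant 1, which recovers `load`; the indicator of X, which gives
-- the numbers d; and the indicator of a fibre of `f`, which gives the loads of `g` inside that
-- fibre.
fib : (Fin n → ℕ) → (Fin n → Fin p) → Fin p → ℕ
fib u f v = sum (λ a → u a * δ (f a) v)

load : (Fin n → Fin p) → Fin p → ℕ
load f v = sum (λ a → δ (f a) v)

sum-over-fibres : (u : Fin n → ℕ) (f : Fin n → Fin p) (w : Fin p → ℕ) →
                  sum (λ a → u a * w (f a)) ≡ sum (λ v → w v * fib u f v)
sum-over-fibres {n} {p} u f w = begin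
  sum (λ a → u a * w (f a))
    ≡⟨ sum-cong-≗ (λ a → cong (u a *_) (sym (sum-δ w (f a)))) ⟩
  sum (λ a → u a * sum (λ v → w v * δ (f a) v))
    ≡⟨ sum-cong-≗ (λ a → *-distribˡ-sum (u a) (λ v → w v * δ (f a) v)) ⟩
  sum (λ a → sum (λ v → u a * (w v * δ (f a) v)))
    ≡⟨ ∑-comm (λ a v → u a * (w v * δ (f a) v)) ⟩
  sum (λ v → sum (λ a → u a * (w v * δ (f a) v)))
    ≡⟨ sum-cong-≗ (λ v → sum-cong-≗ (λ a → swap (u a) (w v) (δ (f a) v))) ⟩
  sum (λ v → sum (λ a → w v * (u a * δ (f a) v)))
    ≡⟨ sum-cong-≗ (λ v → sym (*-distribˡ-sum (w v) (λ a → u a * δ (f a) v))) ⟩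
  sum (λ v → w v * fib u f v) ∎
  where
  open ≡-Reasoning
  swap : ∀ x y z → x * (y * z) ≡ y * (x * z)
  swap = solve-∀

sum-fib : (u : Fin n → ℕ) (f : Fin n → Fin p) → sum (fib u f) ≡ sum u
sum-fib u f = begin
  sum (fib u f)                ≡⟨ sum-cong-≗ (λ v → sym (*-identityˡ (fib u f v))) ⟩
  sum (λ v → 1 * fib u f v)    ≡⟨ sym (sum-over-fibres u f (λ _ → 1)) ⟩
  sum (λ a → u a * 1)          ≡⟨ sum-cong-≗ (λ a → *-identityʳ (u a)) ⟩
  sum u                        ∎
  where open ≡-Reasoning

fib-mono-≤ : {u u′ : Fin n → ℕ} (f : Fin n → Fin p) → (∀ a → u a ≤ u′ a) → ∀ v → fib u f v ≤ fib u′ f v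
fib-mono-≤ f u≤u′ v = sum-mono-≤ (λ a → *-monoˡ-≤ (δ (f a) v) (u≤u′ a))

load≡fib : (f : Fin n → Fin p) → ∀ v → load f v ≡ fib (λ _ → 1) f v
load≡fib {n} f v = sum-cong-≗ {n} {λ a → δ (f a) v} (λ a → sym (*-identityˡ (δ (f a) v)))

sum-∘ : (f : Fin n → Fin p) (w : Fin p → ℕ) → sum (w ∘ f) ≡ sum (λ v → w v * load f v)
sum-∘ f w = begin
  sum (w ∘ f)                              ≡⟨ sum-cong-≗ (λ a → sym (*-identityˡ (w (f a)))) ⟩
  sum (λ a → 1 * w (f a))                  ≡⟨ sum-over-fibres (λ _ → 1) f w ⟩
  sum (λ v → w v * fib (λ _ → 1) f v)      ≡⟨ sum-cong-≗ (λ v → cong (w v *_) (sym (load≡fib f v))) ⟩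
  sum (λ v → w v * load f v)               ∎
  where open ≡-Reasoning

-- With `w` a vector of loads or the indicator of R, this is how the maximum load k of φ enters the
-- counting.
sum-∘-≤ : (f : Fin n → Fin p) (w : Fin p → ℕ) {k : ℕ} → (∀ v → load f v ≤ k) → sum (w ∘ f) ≤ k * sum w
sum-∘-≤ f w {k} load≤k = begin
  sum (w ∘ f)                  ≡⟨ sum-∘ f w ⟩
  sum (λ v → w v * load f v)   ≤⟨ sum-mono-≤ (λ v → *-monoʳ-≤ (w v) (load≤k v)) ⟩
  sum (λ v → w v * k)          ≡⟨ sum-cong-≗ (λ v → *-comm (w v) k) ⟩
  sum (λ v → k * w v)          ≡⟨ sym (*-distribˡ-sum k w) ⟩
  k * sum w                    ∎
  where open ≤-Reasoning

-- Energy-minimal assignments and alternating paths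

energy : (Fin n → Fin p) → ℕ
energy f = sum (λ v → load f v * load f v)

energy-cong : {f g : Fin n → Fin p} → (∀ a → f a ≡ g a) → energy f ≡ energy g
energy-cong f≗g = sum-cong-≗ (λ v → let eq = sum-cong-≗ (λ a → cong (λ b → δ b v) (f≗g a)) in cong₂ _*_ eq eq)

module Assignments {n p : ℕ} (H : Fin n → Fin p → Set) where

  Valid : (Fin n → Fin p) → Set
  Valid f = ∀ a → H a (f a)

  -- These are walks, whose vertices may repeat. Reachability is then closed under one more edge
  -- without a case distinction, and returns are dealt with in `relocate`.
  data Path (f : Fin n → Fin p) : Fin p → Fin p → ℕ → Set where
    here : ∀ {b} → Path f b b 0
    step : ∀ {b c z l} a → f a ≡ b → H a c → Path f c z l → Path f b z (suc l)

  snoc : ∀ {f b z c l} a → Path f b z l → f a ≡ z → H a c → Path f b c (suc l)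
  snoc a here              eq e = step a eq e here
  snoc a (step a′ eq′ e′ r) eq e = step a′ eq′ e′ (snoc a r eq e)

  _[_↦_] : (Fin n → Fin p) → Fin n → Fin p → Fin n → Fin p
  (f [ a ↦ c ]) a′ = if does (a ≟ a′) then c else f a′

  update-≢ : ∀ f {a a′} c → a ≢ a′ → (f [ a ↦ c ]) a′ ≡ f a′
  update-≢ f {a} {a′} c a≢a′ with a ≟ a′
  ... | yes a≡a′ = contradiction a≡a′ a≢a′
  ... | no _     = refl

  update-valid : ∀ {f a c} → Valid f → H a c → Valid (f [ a ↦ c ])
  update-valid {f} {a} {c} valid e a′ with a ≟ a′
  ... | yes refl = e
  ... | no _     = valid a′

  -- Both sides carry a correction term, so that no subtraction occurs; in this form the equation
  -- also covers `c = f a`.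
  load-update : ∀ f a c v → load (f [ a ↦ c ]) v + δ (f a) v ≡ load f v + δ c v
  load-update f a c v = begin
    load f′ v + δ (f a) v
      ≡⟨ cong (load f′ v +_) (sym (sum-δ (λ _ → δ (f a) v) a)) ⟩
    load f′ v + sum (λ a′ → δ (f a) v * δ a a′)
      ≡⟨ sym (∑-distrib-+ (λ a′ → δ (f′ a′) v) _) ⟩
    sum (λ a′ → δ (f′ a′) v + δ (f a) v * δ a a′)
      ≡⟨ sum-cong-≗ pointwise ⟩
    sum (λ a′ → δ (f a′) v + δ c v * δ a a′)
      ≡⟨ ∑-distrib-+ (λ a′ → δ (f a′) v) _ ⟩
    load f v + sum (λ a′ → δ c v * δ a a′)
      ≡⟨ cong (load f v +_) (sum-δ (λ _ → δ c v) a) ⟩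
    load f v + δ c v ∎
    where
    open ≡-Reasoning
    f′ = f [ a ↦ c ]
    exchange : ∀ x y → x + y * 1 ≡ y + x * 1
    exchange = solve-∀
    pointwise : ∀ a′ → δ (f′ a′) v + δ (f a) v * δ a a′ ≡ δ (f a′) v + δ c v * δ a a′
    pointwise a′ with a ≟ a′
    ... | yes refl = exchange (δ c v) (δ (f a) v)
    ... | no _     = cong (δ (f a′) v +_) (trans (*-zeroʳ (δ (f a) v)) (sym (*-zeroʳ (δ c v))))

  -- A path that returns to b can be replaced by its suffix from there; one that
  -- avoids b does not see the reassignment of a vertex currently assigned to b.
  relocate : ∀ {f a b c x z l} → f a ≡ b → Path f x z l →
             (∃ λ l′ → l′ ≤ l × Path f b z l′) ⊎ Path (f [ a ↦ c ]) x z l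
  relocate {b = b} {x = x} fa≡b path with x ≟ b
  relocate fa≡b path | yes refl = inj₁ (_ , ≤-refl , path)
  relocate fa≡b here | no _     = inj₂ here
  relocate {f} {a} {c = c} fa≡b (step a′ fa′≡x e rest) | no x≢b with relocate {c = c} fa≡b rest
  ... | inj₁ (l′ , l′≤l , path′) = inj₁ (l′ , m≤n⇒m≤1+n l′≤l , path′)
  ... | inj₂ rest′ = inj₂ (step a′ (trans (update-≢ f c a≢a′) fa′≡x) e rest′)
    where
    a≢a′ : a ≢ a′
    a≢a′ refl = x≢b (trans (sym fa′≡x) fa≡b)

  ShiftsLoad : (f f′ : Fin n → Fin p) → Fin p → Fin p → Set
  ShiftsLoad f f′ b z = ∀ v → load f′ v + δ b v ≡ load f v + δ z v

  ShiftAlong : ℕ → Set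
  ShiftAlong l = ∀ f {b z} → Valid f → Path f b z l → b ≢ z → ∃ λ f′ → Valid f′ × ShiftsLoad f f′ b z

  -- The first vertex `a` moves from `b` to `c`, and the rest of the walk, taken in the updated
  -- assignment, passes the unit gained at `c` on. If the rest returns to `b`, its suffix from there
  -- is strictly shorter than the whole walk and is used with the old assignment.
  shift : ∀ l → ShiftAlong l
  shift = <-rec ShiftAlong go
    where
    go : ∀ l → (∀ {l′} → l′ < l → ShiftAlong l′) → ShiftAlong l
    go _ rec f valid here b≢z = contradiction refl b≢z
    go _ rec f {b} {z} valid (step {c = c} a refl e rest) b≢z with relocate {c = c} refl rest
    ... | inj₁ (l′ , l′≤l , path′) = rec (s≤s l′≤l) f valid path′ b≢z
    ... | inj₂ rest′ with c ≟ z
    ... | yes refl = f [ a ↦ c ] , update-valid valid e , load-update f a c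
    ... | no c≢z with rec ≤-refl (f [ a ↦ c ]) (update-valid valid e) rest′ c≢z
    ... | f″ , valid″ , shift″ = f″ , valid″ , λ v → +-cancelʳ-≡ (δ c v) _ _ (begin
      load f″ v + δ b v + δ c v    ≡⟨ rotate (load f″ v) (δ b v) (δ c v) ⟩
      load f″ v + δ c v + δ b v    ≡⟨ cong (_+ δ b v) (shift″ v) ⟩
      load (f [ a ↦ c ]) v + δ z v + δ b v   ≡⟨ rotate (load (f [ a ↦ c ]) v) (δ z v) (δ b v) ⟩
      load (f [ a ↦ c ]) v + δ b v + δ z v   ≡⟨ cong (_+ δ z v) (load-update f a c v) ⟩
      load f v + δ c v + δ z v     ≡⟨ rotate (load f v) (δ c v) (δ z v) ⟩
      load f v + δ z v + δ c v     ∎)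
      where
      open ≡-Reasoning
      rotate : ∀ x y z → x + y + z ≡ x + z + y
      rotate = solve-∀

  -- With q the load at `z`, the square at `z` grows by exactly 2q + 1, while the square at `b`
  -- shrinks by at least 2q + 3, because the load there is at least q + 2. All other loads are
  -- unchanged.
  shift-energy : ∀ {f f′ b z} → ShiftsLoad f f′ b z → load f z + 2 ≤ load f b → energy f′ < energy f
  shift-energy {f} {f′} {b} {z} shifts gap = +-cancelʳ-≤ (2 * q + 2) (suc (energy f′)) (energy f) (begin
    suc (energy f′) + (2 * q + 2)    ≡⟨ assoc′ (energy f′) q ⟩
    energy f′ + (2 * q + 3)          ≡⟨ cong (energy f′ +_) (sym (sum-δ (λ _ → 2 * q + 3) b)) ⟩
    energy f′ + sum (λ v → (2 * q + 3) * δ b v)  ≡⟨ sym (∑-distrib-+ (λ v → load f′ v * load f′ v) _) ⟩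
    sum (λ v → load f′ v * load f′ v + (2 * q + 3) * δ b v)  ≤⟨ sum-mono-≤ pointwise ⟩
    sum (λ v → load f v * load f v + (2 * q + 1) * δ z v)    ≡⟨ ∑-distrib-+ (λ v → load f v * load f v) _ ⟩
    energy f + sum (λ v → (2 * q + 1) * δ z v)   ≡⟨ cong (energy f +_) (sum-δ (λ _ → 2 * q + 1) z) ⟩
    energy f + (2 * q + 1)           ≤⟨ +-monoʳ-≤ (energy f) (+-monoʳ-≤ (2 * q) (s≤s z≤n)) ⟩
    energy f + (2 * q + 2)           ∎)
    where
    open ≤-Reasoning
    q = load f z
    assoc′ : ∀ e q → suc e + (2 * q + 2) ≡ e + (2 * q + 3)
    assoc′ = solve-∀
    b≢z : b ≢ z
    b≢z refl = m+1+n≰m q gap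
    at-b : ∀ x y → q + 2 ≤ y → x + 1 ≡ y + 0 → x * x + (2 * q + 3) * 1 ≤ y * y + (2 * q + 1) * 0
    at-b x y q+2≤y eq with m≤n⇒∃[o]m+o≡n q+2≤y
    ... | o , refl with +-cancelʳ-≡ 1 x (q + 1 + o) (trans eq (sym (expand q o)))
      where
      expand : ∀ q o → q + 1 + o + 1 ≡ q + 2 + o + 0
      expand = solve-∀
    ... | refl = ≤-trans (m≤m+n _ (2 * o)) (≤-reflexive (sym (square q o)))
      where
      square : ∀ q o → (q + 2 + o) * (q + 2 + o) + (2 * q + 1) * 0
               ≡ (q + 1 + o) * (q + 1 + o) + (2 * q + 3) * 1 + 2 * o
      square = solve-∀
    at-z : ∀ x → x + 0 ≡ q + 1 → x * x + (2 * q + 3) * 0 ≤ q * q + (2 * q + 1) * 1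
    at-z x eq with trans (sym (+-identityʳ x)) eq
    ... | refl = ≤-reflexive (square q)
      where
      square : ∀ q → (q + 1) * (q + 1) + (2 * q + 3) * 0 ≡ q * q + (2 * q + 1) * 1
      square = solve-∀
    pointwise : ∀ v → load f′ v * load f′ v + (2 * q + 3) * δ b v ≤ load f v * load f v + (2 * q + 1) * δ z v
    pointwise v with b ≟ v | z ≟ v | shifts v
    ... | yes refl | yes refl | _  = contradiction refl b≢z
    ... | yes refl | no _     | eq = at-b (load f′ b) (load f b) gap eq
    ... | no _     | yes refl | eq = at-z (load f′ z) eq
    ... | no _     | no _     | eq with trans (sym (+-identityʳ _)) (trans eq (+-identityʳ _))
    ... | eq′ rewrite eq′ | *-zeroʳ (2 * q + 3) | *-zeroʳ (2 * q + 1) = ≤-refl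

  EnergyMinimal : (Fin n → Fin p) → Set
  EnergyMinimal f = Valid f × (∀ g → Valid g → energy f ≤ energy g)

  path-balanced : ∀ {f b z l} → EnergyMinimal f → Path f b z l → load f b ≤ load f z + 1
  path-balanced {f} {b} {z} {l} (valid , minimal) path with load f b ≤? load f z + 1
  ... | yes le = le
  ... | no ¬le = contradiction (minimal f′ valid′) (<⇒≱ (shift-energy {f} {f′} {b} {z} shifts gap))
    where
    gap : load f z + 2 ≤ load f b
    gap = subst (_≤ load f b) (sym (+-suc (load f z) 1)) (≰⇒> ¬le)
    b≢z : b ≢ z
    b≢z refl = m+1+n≰m (load f z) gap
    shifted = shift l f valid path b≢z
    f′ = proj₁ shifted
    valid′ = proj₁ (proj₂ shifted)
    shifts = proj₂ (proj₂ shifted)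

  edge-balanced : ∀ {f} → EnergyMinimal f → ∀ {a c} → H a c → load f (f a) ≤ load f c + 1
  edge-balanced minimal {a} e = path-balanced minimal (step a refl e here)

  module _ (H? : ∀ a b → Dec (H a b)) where

    assignment : Fin (p ^ n) → Fin n → Fin p
    assignment = finToFun

    candidates : List (Fin (p ^ n))
    candidates = filter (λ i → all? (λ a → H? a (assignment i a))) (allFin (p ^ n))

    -- The default is returned only when no assignment is valid.
    best : (Fin n → Fin p) → List (Fin (p ^ n)) → (Fin n → Fin p)
    best default []       = default
    best default (i ∷ is) = assignment (argmin (energy ∘ assignment) i is)

    balanced : (Fin n → Fin p) → (Fin n → Fin p)
    balanced default = best default candidates

    -- Completeness of the list is asked only up to energy, because decoding the code of `g` gives
    -- `g` back only pointwise. The valid `g₀` rules out the empty list.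
    best-minimal : ∀ default is → (∀ {i} → i ∈ is → Valid (assignment i)) →
                   (∀ g → Valid g → ∃ λ i → i ∈ is × energy (assignment i) ≤ energy g) →
                   ∀ {g₀} → Valid g₀ → EnergyMinimal (best default is)
    best-minimal default [] sound complete {g₀} valid₀ with complete g₀ valid₀
    ... | _ , () , _
    best-minimal default (i ∷ is) sound complete _ = valid , minimal
      where
      valid : Valid (best default (i ∷ is))
      valid with argmin-sel (energy ∘ assignment) i is
      ... | inj₁ eq = subst (Valid ∘ assignment) (sym eq) (sound (here refl))
      ... | inj₂ i∈ = sound (there i∈)
      minimal : ∀ g → Valid g → energy (best default (i ∷ is)) ≤ energy g
      minimal g valid-g with complete g valid-g
      ... | _ , here refl , le = ≤-trans (f[argmin]≤f[⊤] {f = energy ∘ assignment} i is) le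
      ... | _ , there j∈ , le = ≤-trans (All.lookup (f[argmin]≤f[xs] {f = energy ∘ assignment} i is) j∈) le

    balanced-minimal : ∀ default {g₀} → Valid g₀ → EnergyMinimal (balanced default)
    balanced-minimal default = best-minimal default candidates
      (λ i∈ → proj₂ (∈-filter⁻ _ {xs = allFin (p ^ n)} i∈))
      (λ g valid → funToFin g
        , ∈-filter⁺ _ (∈-allFin (funToFin g)) (λ a → subst (H a) (sym (finToFun-funToFin g a)) (valid a))
        , ≤-reflexive (energy-cong {f = assignment (funToFin g)} (finToFun-funToFin g)))
-- Counting inequalities

2xy≤x²+y² : ∀ x y → 2 * (x * y) ≤ x * x + y * y
2xy≤x²+y² x y with ≤-total x y
... | inj₁ x≤y with m≤n⇒∃[o]m+o≡n x≤y
... | o , refl = ≤-trans (m≤m+n _ (o * o)) (≤-reflexive (expand x o))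
  where
  expand : ∀ x o → 2 * (x * (x + o)) + o * o ≡ x * x + (x + o) * (x + o)
  expand = solve-∀
2xy≤x²+y² x y | inj₂ y≤x with m≤n⇒∃[o]m+o≡n y≤x
... | o , refl = ≤-trans (m≤m+n _ (o * o)) (≤-reflexive (expand y o))
  where
  expand : ∀ y o → 2 * ((y + o) * y) + o * o ≡ (y + o) * (y + o) + y * y
  expand = solve-∀

-- The tangent to x³ at c: the two sides differ by (x - c)²(x + 2c).
3c²x≤x³+2c³ : ∀ c x → 3 * (c * c) * x ≤ x * (x * x) + 2 * (c * (c * c))
3c²x≤x³+2c³ c x with ≤-total c x
... | inj₁ c≤x with m≤n⇒∃[o]m+o≡n c≤x
... | o , refl = ≤-trans (m≤m+n _ (o * o * (3 * c + o))) (≤-reflexive (expand c o))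
  where
  expand : ∀ c o → 3 * (c * c) * (c + o) + o * o * (3 * c + o)
           ≡ (c + o) * ((c + o) * (c + o)) + 2 * (c * (c * c))
  expand = solve-∀
3c²x≤x³+2c³ c x | inj₂ x≤c with m≤n⇒∃[o]m+o≡n x≤c
... | o , refl = ≤-trans (m≤m+n _ (o * o * (3 * x + 2 * o))) (≤-reflexive (expand x o))
  where
  expand : ∀ x o → 3 * ((x + o) * (x + o)) * x + o * o * (3 * x + 2 * o)
           ≡ x * (x * x) + 2 * ((x + o) * ((x + o) * (x + o)))
  expand = solve-∀

-- It makes `sum r` an upper bound for the number of places where `e` is nonzero, the quantity by
-- which the power-mean inequalities divide.
Supports : (Fin n → ℕ) → (Fin n → ℕ) → Set
Supports r e = ∀ v → e v ≡ 0 ⊎ 1 ≤ r v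

-- The tangent to x² at the mean of e over its support, with denominators cleared.
sum²≤support*sum-of-squares : {r e : Fin n → ℕ} → Supports r e → 1 ≤ sum r →
                              sum e * sum e ≤ sum r * sum (λ v → e v * e v)
sum²≤support*sum-of-squares {r = r} {e} supp t≥1 = *-cancelˡ-≤ t {{>-nonZero t≥1}} (+-cancelʳ-≤ (s * s * t) _ _ (begin
  t * (s * s) + s * s * t                          ≡⟨ double t s ⟩
  2 * (t * s) * s                                  ≡⟨ *-distribˡ-sum (2 * (t * s)) e ⟩
  sum (λ v → 2 * (t * s) * e v)                    ≤⟨ sum-mono-≤ pointwise ⟩
  sum (λ v → t * t * (e v * e v) + s * s * r v)    ≡⟨ ∑-distrib-+ (λ v → t * t * (e v * e v)) _ ⟩
  sum (λ v → t * t * (e v * e v)) + sum (λ v → s * s * r v)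
    ≡⟨ sym (cong₂ _+_ (*-distribˡ-sum (t * t) (λ v → e v * e v)) (*-distribˡ-sum (s * s) r)) ⟩
  t * t * q + s * s * t                            ≡⟨ cong (_+ s * s * t) (*-assoc t t q) ⟩
  t * (t * q) + s * s * t                          ∎))
  where
  open ≤-Reasoning
  t = sum r
  s = sum e
  q = sum (λ v → e v * e v)
  double : ∀ t s → t * (s * s) + s * s * t ≡ 2 * (t * s) * s
  double = solve-∀
  regroup : ∀ t s x → 2 * (t * s) * x ≡ 2 * ((t * x) * s)
  regroup = solve-∀
  regroup′ : ∀ t s x → (t * x) * (t * x) + s * s ≡ t * t * (x * x) + s * s * 1
  regroup′ = solve-∀
  pointwise : ∀ v → 2 * (t * s) * e v ≤ t * t * (e v * e v) + s * s * r v
  pointwise v with supp v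
  ... | inj₁ eq rewrite eq | *-zeroʳ (2 * (t * s)) = z≤n
  ... | inj₂ 1≤r = begin
    2 * (t * s) * e v                      ≡⟨ regroup t s (e v) ⟩
    2 * ((t * e v) * s)                    ≤⟨ 2xy≤x²+y² (t * e v) s ⟩
    (t * e v) * (t * e v) + s * s          ≡⟨ regroup′ t s (e v) ⟩
    t * t * (e v * e v) + s * s * 1        ≤⟨ +-monoʳ-≤ (t * t * (e v * e v)) (*-monoʳ-≤ (s * s) 1≤r) ⟩
    t * t * (e v * e v) + s * s * r v      ∎

-- The tangents at `c`, summed over the support, bound the sum of cubes from below by 3c² · `sum e`
-- - 2c³ · `sum r`, and `sum e` is at least c · `sum r`.
mean³≤sum-of-cubes : {r e : Fin n → ℕ} (c : ℕ) → Supports r e → c * sum r ≤ sum e →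
                     sum r * (c * (c * c)) ≤ sum (λ v → e v * (e v * e v))
mean³≤sum-of-cubes {r = r} {e} c supp ct≤s = +-cancelʳ-≤ (2 * c³ * t) _ _ (begin
  t * c³ + 2 * c³ * t                              ≡⟨ regroup t c ⟩
  3 * (c * c) * (c * t)                            ≤⟨ *-monoʳ-≤ (3 * (c * c)) ct≤s ⟩
  3 * (c * c) * sum e                              ≡⟨ *-distribˡ-sum (3 * (c * c)) e ⟩
  sum (λ v → 3 * (c * c) * e v)                    ≤⟨ sum-mono-≤ pointwise ⟩
  sum (λ v → e v * (e v * e v) + 2 * c³ * r v)     ≡⟨ ∑-distrib-+ (λ v → e v * (e v * e v)) _ ⟩
  sum (λ v → e v * (e v * e v)) + sum (λ v → 2 * c³ * r v)
    ≡⟨ cong (sum (λ v → e v * (e v * e v)) +_) (sym (*-distribˡ-sum (2 * c³) r)) ⟩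
  sum (λ v → e v * (e v * e v)) + 2 * c³ * t       ∎)
  where
  open ≤-Reasoning
  t = sum r
  c³ = c * (c * c)
  regroup : ∀ t c → t * (c * (c * c)) + 2 * (c * (c * c)) * t ≡ 3 * (c * c) * (c * t)
  regroup = solve-∀
  pointwise : ∀ v → 3 * (c * c) * e v ≤ e v * (e v * e v) + 2 * c³ * r v
  pointwise v with supp v
  ... | inj₁ eq rewrite eq | *-zeroʳ (3 * (c * c)) = z≤n
  ... | inj₂ 1≤r = begin
    3 * (c * c) * e v                      ≤⟨ 3c²x≤x³+2c³ c (e v) ⟩
    e v * (e v * e v) + 2 * c³             ≡⟨ cong (e v * (e v * e v) +_) (sym (*-identityʳ (2 * c³))) ⟩
    e v * (e v * e v) + 2 * c³ * 1         ≤⟨ +-monoʳ-≤ (e v * (e v * e v)) (*-monoʳ-≤ (2 * c³) 1≤r) ⟩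
    e v * (e v * e v) + 2 * c³ * r v       ∎

-- The implication goes one way: the marked vertices may be a proper subset of those satisfying `P`,
-- so that `P` can be weakened while `χ` stays fixed.
Indicates : (Fin n → ℕ) → (Fin n → Set) → Set
Indicates χ P = ∀ a → χ a ≡ 0 ⊎ (χ a ≡ 1 × P a)

indicates-map : {χ : Fin n → ℕ} {P Q : Fin n → Set} → (∀ a → P a → Q a) → Indicates χ P → Indicates χ Q
indicates-map P⇒Q ind a with ind a
... | inj₁ χ≡0       = inj₁ χ≡0
... | inj₂ (χ≡1 , x) = inj₂ (χ≡1 , P⇒Q a x)

indicates-≤1 : {χ : Fin n → ℕ} {P : Fin n → Set} → Indicates χ P → ∀ a → χ a ≤ 1
indicates-≤1 ind a with ind a
... | inj₁ χ≡0       = ≤-trans (≤-reflexive χ≡0) z≤n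
... | inj₂ (χ≡1 , _) = ≤-reflexive χ≡1

fib-supported : {χ : Fin n → ℕ} {r : Fin p → ℕ} {g : Fin n → Fin p} →
                Indicates χ (λ a → 1 ≤ r (g a)) → Supports r (fib χ g)
fib-supported {n} {χ = χ} {r} {g} ind v with r v in eq
... | suc _ = inj₂ (s≤s z≤n)
... | zero  = inj₁ (trans (sum-cong-≗ vanish) (sum-0 n))
  where
  vanish : ∀ a → χ a * δ (g a) v ≡ 0
  vanish a with ind a
  ... | inj₁ χ≡0 rewrite χ≡0 = refl
  ... | inj₂ (_ , 1≤r) with g a ≟ v
  ... | no _ = *-zeroʳ (χ a)
  ... | yes refl = contradiction (≤-trans 1≤r (≤-reflexive eq)) (λ ())

-- Every vertex counted by χ could move to φ a, whose load is almost as large as that of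
-- g a; since φ hits each target at most k times, these loads add up to at most k times
-- the total load.
sum-of-loads-≤ : ∀ {k} {φ g : Fin n → Fin p} (ℓ : Fin p → ℕ) {χ : Fin n → ℕ} → (∀ v → load φ v ≤ k) →
                 Indicates χ (λ a → ℓ (g a) ≤ ℓ (φ a) + 1) →
                 sum (λ a → χ a * ℓ (g a)) ≤ k * sum ℓ + sum χ
sum-of-loads-≤ {k = k} {φ} {g} ℓ {χ} load≤k ind = begin
  sum (λ a → χ a * ℓ (g a))          ≤⟨ sum-mono-≤ pointwise ⟩
  sum (λ a → ℓ (φ a) + χ a)          ≡⟨ ∑-distrib-+ (ℓ ∘ φ) χ ⟩
  sum (ℓ ∘ φ) + sum χ                ≤⟨ +-monoˡ-≤ (sum χ) (sum-∘-≤ φ ℓ load≤k) ⟩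
  k * sum ℓ + sum χ                  ∎
  where
  open ≤-Reasoning
  pointwise : ∀ a → χ a * ℓ (g a) ≤ ℓ (φ a) + χ a
  pointwise a with ind a
  ... | inj₁ χ≡0 rewrite χ≡0 = z≤n
  ... | inj₂ (χ≡1 , le) rewrite χ≡1 | *-identityˡ (ℓ (g a)) = le

-- Cauchy-Schwarz over the fibres of `g`, which lie over R; then one factor of each squared fibre
-- size is replaced by `ℓ`, which leaves a sum of loads over X. `ℓ` is kept general to serve both
-- for all loads of `f` and for the loads of `g` inside one fibre of `f`.
indicated²-≤ : ∀ {k} {φ g : Fin n → Fin p} (ℓ : Fin p → ℕ) {χ : Fin n → ℕ} {r : Fin p → ℕ} →
               (∀ v → load φ v ≤ k) → 1 ≤ sum r → (∀ v → fib χ g v ≤ ℓ v) →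
               Indicates χ (λ a → 1 ≤ r (g a) × ℓ (g a) ≤ ℓ (φ a) + 1) →
               sum χ * sum χ ≤ sum r * (k * sum ℓ + sum χ)
indicated²-≤ {k = k} {φ} {g} ℓ {χ} {r} load≤k t≥1 fib≤ℓ ind = begin
  sum χ * sum χ                                  ≡⟨ sym (cong₂ _*_ (sum-fib χ g) (sum-fib χ g)) ⟩
  sum (fib χ g) * sum (fib χ g)
    ≤⟨ sum²≤support*sum-of-squares (fib-supported {χ = χ} {g = g} (indicates-map (λ _ → proj₁) ind)) t≥1 ⟩
  sum r * sum (λ v → fib χ g v * fib χ g v)
    ≤⟨ *-monoʳ-≤ (sum r) (sum-mono-≤ (λ v → *-monoˡ-≤ (fib χ g v) (fib≤ℓ v))) ⟩
  sum r * sum (λ v → ℓ v * fib χ g v)            ≡⟨ cong (sum r *_) (sym (sum-over-fibres χ g ℓ)) ⟩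
  sum r * sum (λ a → χ a * ℓ (g a))
    ≤⟨ *-monoʳ-≤ (sum r) (sum-of-loads-≤ {φ = φ} {g} ℓ load≤k (indicates-map (λ _ → proj₂) ind)) ⟩
  sum r * (k * sum ℓ + sum χ)                    ∎
  where open ≤-Reasoning

sum-load : (f : Fin n → Fin p) → sum (load f) ≡ n
sum-load {n} f = begin
  sum (load f)              ≡⟨ sum-cong-≗ (load≡fib f) ⟩
  sum (fib (λ _ → 1) f)     ≡⟨ sum-fib (λ _ → 1) f ⟩
  sum {n} (λ _ → 1)         ≡⟨ sum-1 n ⟩
  n                         ∎
  where open ≡-Reasoning

fib≤load : {χ : Fin n → ℕ} (f : Fin n → Fin p) → (∀ a → χ a ≤ 1) → ∀ v → fib χ f v ≤ load f v
fib≤load f χ≤1 v = ≤-trans (fib-mono-≤ f χ≤1 v) (≤-reflexive (sym (load≡fib f v)))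

-- Write x for `sum χ` and t for `sum r`. From x² ≤ t(kn + x) follows x(x - t) ≤ tkn. Here x ≥ yt,
-- and x - t ≥ (y - 1)t + 1 ≥ y thanks to the `+ 1` in the hypothesis on x. Dividing by t gives the
-- claim.
one-assignment-bound : ∀ {k y} {φ f : Fin n → Fin p} {χ : Fin n → ℕ} {r : Fin p → ℕ} →
  (∀ v → load φ v ≤ k) → 1 ≤ sum r → 1 ≤ y → y * sum r + 1 ≤ sum χ →
  Indicates χ (λ a → 1 ≤ r (f a) × load f (f a) ≤ load f (φ a) + 1) →
  y * y ≤ k * n
one-assignment-bound {n} {k = k} {suc y} {φ} {f} {χ} {r} load≤k t≥1 _ many ind =
  *-cancelˡ-≤ t {{>-nonZero t≥1}} (begin
    t * (suc y * suc y)        ≡⟨ regroup t (suc y) ⟩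
    suc y * (suc y * t)        ≤⟨ *-monoʳ-≤ (suc y) (m+n≤o⇒m≤o _ many) ⟩
    suc y * x                  ≤⟨ *-monoˡ-≤ x suc-y≤ ⟩
    (y * t + 1) * x            ≤⟨ +-cancelʳ-≤ (t * x) _ _ key ⟩
    t * (k * n)                ∎)
  where
  open ≤-Reasoning
  t = sum r
  x = sum χ
  regroup : ∀ t y → t * (y * y) ≡ y * (y * t)
  regroup = solve-∀
  expand : ∀ y t x → (y * t + 1) * x + t * x ≡ (t + y * t + 1) * x
  expand = solve-∀
  suc-y≤ : suc y ≤ y * t + 1
  suc-y≤ = ≤-trans (≤-reflexive (trans (+-comm 1 y) (cong (_+ 1) (sym (*-identityʳ y)))))
                   (+-monoˡ-≤ 1 (*-monoʳ-≤ y t≥1))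
  key : (y * t + 1) * x + t * x ≤ t * (k * n) + t * x
  key = begin
    (y * t + 1) * x + t * x    ≡⟨ expand y t x ⟩
    (suc y * t + 1) * x        ≤⟨ *-monoˡ-≤ x many ⟩
    x * x                      ≤⟨ indicated²-≤ {φ = φ} {f} (load f) load≤k t≥1 (fib≤load f (indicates-≤1 ind)) ind ⟩
    t * (k * sum (load f) + x) ≡⟨ cong (λ s → t * (k * s + x)) (sum-load f) ⟩
    t * (k * n + x)            ≡⟨ *-distribˡ-+ t (k * n) x ⟩
    t * (k * n) + t * x        ∎

-- The mean of d over R is at least y, so the cubes of d add up to at least ty³. The upper bound
-- carries exactly one factor t, from Cauchy-Schwarz inside the fibres, and the two cancel.
two-assignments-bound : ∀ {k y} {φ f g : Fin n → Fin p} {χ : Fin n → ℕ} {r : Fin p → ℕ} →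
  (∀ v → load φ v ≤ k) → 1 ≤ k → 1 ≤ sum r → y * sum r ≤ sum χ →
  Indicates χ (λ a → 1 ≤ r (f a) × load f (f a) ≤ load f (φ a) + 1) →
  Indicates χ (λ a → 1 ≤ r (g a) × fib (λ a′ → δ (f a′) (f a)) g (g a) ≤ fib (λ a′ → δ (f a′) (f a)) g (φ a) + 1) →
  y * (y * y) ≤ 4 * (k * k) * n
two-assignments-bound {n} {k = k} {y} {φ} {f} {g} {χ} {r} load≤k k≥1 t≥1 many ind-f ind-g =
  *-cancelˡ-≤ t {{>-nonZero t≥1}} (begin
    t * (y * (y * y))                         ≤⟨ mean³≤sum-of-cubes y (fib-supported {χ = χ} {g = f} (indicates-map (λ _ → proj₁) ind-f))
                                                   (≤-trans many (≤-reflexive (sym (sum-fib χ f)))) ⟩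
    sum (λ v → d v * (d v * d v))             ≤⟨ sum-mono-≤ (λ v → *-monoʳ-≤ (d v) (d²≤ v)) ⟩
    sum (λ v → d v * (2 * t * k * load f v))  ≡⟨ sum-cong-≗ (λ v → swap (d v) (2 * t * k) (load f v)) ⟩
    sum (λ v → 2 * t * k * (load f v * d v))  ≡⟨ sym (*-distribˡ-sum (2 * t * k) (λ v → load f v * d v)) ⟩
    2 * t * k * sum (λ v → load f v * d v)    ≡⟨ cong (2 * t * k *_) (sym (sum-over-fibres χ f (load f))) ⟩
    2 * t * k * sum (λ a → χ a * load f (f a))
      ≤⟨ *-monoʳ-≤ (2 * t * k) (sum-of-loads-≤ {φ = φ} {f} (load f) load≤k (indicates-map (λ _ → proj₂) ind-f)) ⟩
    2 * t * k * (k * sum (load f) + sum χ)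
      ≤⟨ *-monoʳ-≤ (2 * t * k) (+-mono-≤ (≤-reflexive (cong (k *_) (sum-load f))) x≤kn) ⟩
    2 * t * k * (k * n + k * n)               ≡⟨ collect t k n ⟩
    t * (4 * (k * k) * n)                     ∎)
  where
  open ≤-Reasoning
  t = sum r
  d = fib χ f
  χ≤1 = indicates-≤1 ind-f
  swap : ∀ x c l → x * (c * l) ≡ c * (l * x)
  swap = solve-∀
  collect : ∀ t k n → 2 * t * k * (k * n + k * n) ≡ t * (4 * (k * k) * n)
  collect = solve-∀
  double : ∀ t k l → t * (k * l + k * l) ≡ 2 * t * k * l
  double = solve-∀
  n≤kn : ∀ n → n ≤ k * n
  n≤kn n = ≤-trans (≤-reflexive (sym (*-identityˡ n))) (*-monoˡ-≤ n k≥1)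
  x≤kn : sum χ ≤ k * n
  x≤kn = ≤-trans (sum-mono-≤ χ≤1) (≤-trans (≤-reflexive (sum-1 n)) (n≤kn n))
  -- Restricting X to one fibre of `f` turns balance relative to `f a` into balance relative to the
  -- fixed vertex `v`.
  ind-v : ∀ v → Indicates (λ a → χ a * δ (f a) v)
            (λ a → 1 ≤ r (g a) × fib (λ a′ → δ (f a′) v) g (g a) ≤ fib (λ a′ → δ (f a′) v) g (φ a) + 1)
  ind-v v a with ind-g a
  ... | inj₁ χ≡0 rewrite χ≡0 = inj₁ refl
  ... | inj₂ (χ≡1 , bal) rewrite χ≡1 with f a ≟ v
  ... | no _     = inj₁ refl
  ... | yes refl = inj₂ (refl , bal)
  d²≤ : ∀ v → d v * d v ≤ 2 * t * k * load f v
  d²≤ v = begin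
    d v * d v
      ≤⟨ indicated²-≤ {φ = φ} {g} (fib (λ a → δ (f a) v) g) load≤k t≥1
           (fib-mono-≤ g (λ a → ≤-trans (*-monoˡ-≤ (δ (f a) v) (χ≤1 a)) (≤-reflexive (*-identityˡ _)))) (ind-v v) ⟩
    t * (k * sum (fib (λ a → δ (f a) v) g) + d v)
      ≡⟨ cong (λ s → t * (k * s + d v)) (sum-fib (λ a → δ (f a) v) g) ⟩
    t * (k * load f v + d v)
      ≤⟨ *-monoʳ-≤ t (+-monoʳ-≤ (k * load f v) (≤-trans (fib≤load f χ≤1 v) (n≤kn (load f v)))) ⟩
    t * (k * load f v + k * load f v)  ≡⟨ double t k (load f v) ⟩
    2 * t * k * load f v               ∎

-- Semi-matchings as assignments

∨-true : ∀ x y → x ∨ y ≡ true → x ≡ true ⊎ y ≡ true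
∨-true true  y eq = inj₁ refl
∨-true false y eq = inj₂ eq

does-true : {P : Set} (d : Dec P) → does d ≡ true → P
does-true (yes p) _ = p

count-witness : (f : Fin n → Bool) → 1 ≤ count f → ∃ λ i → f i ≡ true
count-witness {suc n} f pos with f zero in eq
... | true  = zero , eq
... | false with count-witness (f ∘ suc) pos
... | i , fi = suc i , fi

≤maxOver : (f : Fin n → ℕ) (i : Fin n) → f i ≤ maxOver f
≤maxOver f zero    = m≤m⊔n _ _
≤maxOver f (suc i) = ≤-trans (≤maxOver (f ∘ suc) i) (m≤n⊔m (f zero) _)

≤⊔-split : ∀ {t} x y → t ≤ x ⊔ y → t ≤ x ⊎ t ≤ y
≤⊔-split x y t≤ with ⊔-sel x y
... | inj₁ eq = inj₁ (≤-trans t≤ (≤-reflexive eq))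
... | inj₂ eq = inj₂ (≤-trans t≤ (≤-reflexive eq))

-- `1 ≤ t` excludes the empty family, whose maximum is 0 by convention.
maxOver-attained : ∀ {t} (f : Fin n → ℕ) → 1 ≤ t → t ≤ maxOver f → ∃ λ i → t ≤ f i
maxOver-attained {zero}  f t≥1 t≤ = contradiction (≤-trans t≥1 t≤) λ ()
maxOver-attained {suc n} f t≥1 t≤ with ≤⊔-split (f zero) _ t≤
... | inj₁ le = zero , le
... | inj₂ le with maxOver-attained (f ∘ suc) t≥1 le
... | i , le′ = suc i , le′

graph : (Fin n → Fin m) → EdgeSet n m
graph f a b = does (f a ≟ b)

degA-graph : (f : Fin n → Fin m) → ∀ a → degA (graph f) a ≡ 1
degA-graph f a = trans (count≡sum (graph f a)) (sum-δ-row (f a))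

degB-graph : (f : Fin n → Fin m) → ∀ b → degB (graph f) b ≡ load f b
degB-graph f b = count≡sum (λ a → graph f a b)

1≤load : (f : Fin n → Fin p) (a : Fin n) → 1 ≤ load f (f a)
1≤load f a = ≤-trans (≤-reflexive (sym (δ-refl (f a)))) (term≤sum (λ a′ → δ (f a′) (f a)) a)

-- The maximum degree also ranges over A, but degrees there are 1, and the image of any vertex of A
-- has load at least 1.
degMax-attained : ∀ {t} (f : Fin n → Fin m) → 1 ≤ t → t ≤ degMax (graph f) → ∃ λ b → t ≤ load f b
degMax-attained f t≥1 t≤ with ≤⊔-split (maxOver (degA (graph f))) _ t≤
... | inj₁ le with maxOver-attained (degA (graph f)) t≥1 le
... | a , le′ = f a , ≤-trans le′ (≤-trans (≤-reflexive (degA-graph f a)) (1≤load f a))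
degMax-attained f t≥1 t≤ | inj₂ le with maxOver-attained (degB (graph f)) t≥1 le
... | b , le′ = b , ≤-trans le′ (≤-reflexive (degB-graph f b))

module SemiMatching {E S : EdgeSet n m} (sm : IsSemiMatching E S) where

  matched : ∀ a → ∃ λ b → S a b ≡ true
  matched a = count-witness (S a) (≤-reflexive (sym (proj₂ sm a)))

  partner : Fin n → Fin m
  partner a = proj₁ (matched a)

  partner-edge : ∀ a → E a (partner a) ≡ true
  partner-edge a = proj₁ sm a (partner a) (proj₂ (matched a))

  load-partner : ∀ b → load partner b ≤ degMax S
  load-partner b = begin
    load partner b          ≤⟨ sum-mono-≤ pointwise ⟩
    sum (λ a → ⟦ S a b ⟧)   ≡⟨ sym (count≡sum (λ a → S a b)) ⟩
    degB S b                ≤⟨ ≤maxOver (degB S) b ⟩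
    maxOver (degB S)        ≤⟨ m≤n⊔m (maxOver (degA S)) _ ⟩
    degMax S                ∎
    where
    open ≤-Reasoning
    pointwise : ∀ a → δ (partner a) b ≤ ⟦ S a b ⟧
    pointwise a with partner a ≟ b
    ... | no _     = z≤n
    ... | yes refl = ≤-reflexive (cong ⟦_⟧ (sym (proj₂ (matched a))))

  1≤degMax : Fin n → 1 ≤ degMax S
  1≤degMax a = ≤-trans (≤-reflexive (sym (proj₂ sm a))) (≤-trans (≤maxOver (degA S) a) (m≤m⊔n _ _))

-- Congestion in Bob's graph

Edge : EdgeSet n m → Fin n → Fin m → Set
Edge E a b = E a b ≡ true

edge? : (E : EdgeSet n m) → ∀ a b → Dec (Edge E a b)
edge? E a b = E a b Bool.≟ true

-- Excluded middle holds up to double negation, hence also for finitely many propositions at once.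
-- Reachability can thus serve as an indicator: the bound proved in the end is decidable and absorbs
-- the double negation.
¬¬-decidable : (P : Fin n → Set) → ¬ ¬ (∀ v → Dec (P v))
¬¬-decidable {zero}  P ¬dec = ¬dec λ ()
¬¬-decidable {suc n} P ¬dec = ¬¬-excluded-middle λ P₀? → ¬¬-decidable (P ∘ suc) λ P₊? →
  ¬dec λ { zero → P₀? ; (suc v) → P₊? v }

-- A set of vertices (indicator χ) all of whose edges in H end in a set (indicator r) that
-- is too small for it, although φ spreads it out along edges of E₁.
record Congestion (E₁ H : EdgeSet n m) (k y : ℕ) : Set where
  field
    φ        : Fin n → Fin m
    load≤k   : ∀ v → load φ v ≤ k
    r        : Fin m → ℕ
    1≤|r|    : 1 ≤ sum r
    χ        : Fin n → ℕ
    crowded  : y * sum r + 1 ≤ sum χ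
    confined : Indicates χ (λ a → Edge E₁ a (φ a) × (∀ c → Edge H a c → 1 ≤ r c))

module Congested {E₁ E₂ H S* : EdgeSet n m} (E₂⊆H : E₂ ⊆E H) (sm* : IsSemiMatching (E₁ ∪E E₂) S*)
                 {F : Fin n → Fin m} (minimal : Assignments.EnergyMinimal (Edge H) F) where

  open Assignments (Edge H)
  open SemiMatching {E = E₁ ∪E E₂} sm*

  Reachable : Fin m → Fin m → Set
  Reachable b₀ v = ∃ λ l → Path F b₀ v l

  -- For k = k′ + 1 and T = D + 2k the factor T - k - 1 is D + k′. The extra 1 in `crowded` comes
  -- from `b₀`, whose load is at least T and not merely T - 1.
  congestion-at : ∀ {k′ D b₀} → degMax S* ≡ suc k′ → D + 2 * suc k′ ≤ load F b₀ →
                  (∀ v → Dec (Reachable b₀ v)) → Congestion E₁ H (suc k′) (D + k′)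
  congestion-at {k′} {D} {b₀} k≡ heavy reach? = record
    { φ = partner ; load≤k = load≤k ; r = r ; 1≤|r| = 1≤|r| ; χ = χ ; crowded = crowded ; confined = confined }
    where
    open ≤-Reasoning
    k = suc k′
    T = D + 2 * k
    r : Fin m → ℕ
    r v = ⟦ does (reach? v) ⟧
    t = sum r
    load≤k : ∀ v → load partner v ≤ k
    load≤k v = ≤-trans (load-partner v) (≤-reflexive k≡)
    r-reachable : ∀ {v} → Reachable b₀ v → r v ≡ 1
    r-reachable {v} p = cong ⟦_⟧ (dec-true (reach? v) p)
    1≤|r| : 1 ≤ t
    1≤|r| = ≤-trans (≤-reflexive (sym (r-reachable (0 , here)))) (term≤sum r b₀)
    closed : ∀ {a c} → Reachable b₀ (F a) → Edge H a c → 1 ≤ r c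
    closed {a} (l , path) e = ≤-reflexive (sym (r-reachable (suc l , snoc a path refl e)))
    χ : Fin n → ℕ
    χ a = r (F a) * ⟦ E₁ a (partner a) ⟧
    confined : Indicates χ (λ a → Edge E₁ a (partner a) × (∀ c → Edge H a c → 1 ≤ r c))
    confined a with reach? (F a) | E₁ a (partner a)
    ... | no _  | _     = inj₁ refl
    ... | yes _ | false = inj₁ refl
    ... | yes p | true  = inj₂ (refl , refl , λ _ e → closed p e)
    -- Free of subtraction: the load is at least T - 1 on R and at least T at `b₀`.
    heavy-everywhere : ∀ v → T * r v + δ b₀ v ≤ r v * load F v + r v
    heavy-everywhere v with reach? v
    ... | no ¬p rewrite *-zeroʳ T with b₀ ≟ v
    ...   | yes refl = contradiction (0 , here) ¬p
    ...   | no _     = z≤n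
    heavy-everywhere v | yes (l , path) with b₀ ≟ v
    ...   | yes refl rewrite *-identityʳ T | +-identityʳ (load F v) = +-monoˡ-≤ 1 heavy
    ...   | no _     rewrite *-identityʳ T | +-identityʳ (load F v) | +-identityʳ T =
              ≤-trans heavy (path-balanced {F} {b₀} {v} minimal path)
    -- If the partner edge of a vertex assigned into R is not in E₁, it is in E₂ and so in H, and
    -- the partner lies in R as well. At most k · `sum r` vertices have their partner in R.
    split : ∀ a → r (F a) ≤ χ a + r (partner a)
    split a with reach? (F a) | E₁ a (partner a) in eq
    ... | no _  | _     = z≤n
    ... | yes p | true  = m≤m+n 1 _
    ... | yes p | false = closed p (E₂⊆H a (partner a) (subst (λ e → e ∨ E₂ a (partner a) ≡ true) eq (partner-edge a)))
    heavy-total : T * t + 1 ≤ (sum χ + k * t) + t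
    heavy-total = begin
      T * t + 1                                      ≡⟨ cong₂ _+_ (*-distribˡ-sum T r) (sym (sum-δ-row b₀)) ⟩
      sum (λ v → T * r v) + sum (δ b₀)               ≡⟨ sym (∑-distrib-+ (λ v → T * r v) (δ b₀)) ⟩
      sum (λ v → T * r v + δ b₀ v)                   ≤⟨ sum-mono-≤ heavy-everywhere ⟩
      sum (λ v → r v * load F v + r v)               ≡⟨ ∑-distrib-+ (λ v → r v * load F v) r ⟩
      sum (λ v → r v * load F v) + t                 ≡⟨ cong (_+ t) (sym (sum-∘ F r)) ⟩
      sum (r ∘ F) + t                                ≤⟨ +-monoˡ-≤ t (sum-mono-≤ split) ⟩
      sum (λ a → χ a + r (partner a)) + t            ≡⟨ cong (_+ t) (∑-distrib-+ χ (r ∘ partner)) ⟩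
      (sum χ + sum (r ∘ partner)) + t                ≤⟨ +-monoˡ-≤ t (+-monoʳ-≤ (sum χ) (sum-∘-≤ partner r load≤k)) ⟩
      (sum χ + k * t) + t                            ∎
    crowded : (D + k′) * t + 1 ≤ sum χ
    crowded = +-cancelʳ-≤ (k * t + t) _ _ (begin
      (D + k′) * t + 1 + (k * t + t)    ≡⟨ collect D k′ t ⟩
      T * t + 1                         ≤⟨ heavy-total ⟩
      (sum χ + k * t) + t               ≡⟨ +-assoc (sum χ) (k * t) t ⟩
      sum χ + (k * t + t)               ∎)
      where
      collect : ∀ D k′ t → (D + k′) * t + 1 + (suc k′ * t + t) ≡ (D + 2 * suc k′) * t + 1
      collect = solve-∀

  congestion : ∀ {D} → 1 ≤ D → D + 2 * degMax S* ≤ degMax (graph F) →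
               ¬ ¬ ∃ λ k′ → degMax S* ≡ suc k′ × Congestion E₁ H (suc k′) (D + k′)
  congestion {D} D≥1 large ¬goal with degMax-attained F (≤-trans D≥1 (m≤m+n D _)) large
  ... | b₀ , heavy with degMax S* in k≡ | 1≤degMax
  ...   | suc k′ | _   = ¬¬-decidable (Reachable b₀) λ reach? → ¬goal (k′ , refl , congestion-at k≡ heavy reach?)
  -- A semi-matching of maximum degree 0 forces A to be empty, and then no load is positive.
  ...   | zero   | pos = contradiction (≤-trans D≥1 (≤-trans (m≤m+n D 0) heavy)) (<⇒≱ (s≤s load≡0))
    where
    load≡0 : load F b₀ ≤ 0
    load≡0 = ≤-trans (sum-mono-≤ (λ a → contradiction (pos a) λ ())) (≤-reflexive (sum-0 n))

-- Alice's assignments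

module Alice {n m : ℕ} (E₁ : EdgeSet n (suc m)) where

  -- Vertices without an edge of E₁ may be assigned anywhere: this only adds to the loads.
  Allowed : Fin n → Fin (suc m) → Set
  Allowed a b = Edge E₁ a b ⊎ (∀ c → E₁ a c ≡ false)

  allowed? : ∀ a b → Dec (Allowed a b)
  allowed? a b = edge? E₁ a b ⊎-dec all? (λ c → E₁ a c Bool.≟ false)

  allowed-edge : ∀ {a b c} → Edge E₁ a b → Allowed a c → Edge E₁ a c
  allowed-edge e (inj₁ e′)  = e′
  allowed-edge e (inj₂ all) = contradiction (trans (sym e) (all _)) λ ()

  some-allowed : ∀ a → ∃ (Allowed a)
  some-allowed a with any? (edge? E₁ a)
  ... | yes (b , e) = b , inj₁ e
  ... | no none     = zero , inj₂ (λ c → Bool.¬-not (λ e → none (c , e)))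

  first : Fin n → Fin (suc m)
  first = Assignments.balanced Allowed allowed? (λ _ → zero)

  first-minimal : Assignments.EnergyMinimal Allowed first
  first-minimal = Assignments.balanced-minimal Allowed allowed? _ (proj₂ ∘ some-allowed)

  first-edge : ∀ {a b} → Edge E₁ a b → Edge E₁ a (first a)
  first-edge e = allowed-edge e (proj₁ first-minimal _)

  first-balanced : ∀ {a b} → Edge E₁ a b → load first (first a) ≤ load first b + 1
  first-balanced e = Assignments.edge-balanced Allowed {first} first-minimal (inj₁ e)

  -- Balancing every fibre of first separately is balancing over pairs (first a , b).
  PairAllowed : Fin n → Fin (suc m * suc m) → Set
  PairAllowed a c = quotient {suc m} (suc m) c ≡ first a × Allowed a (remainder {suc m} (suc m) c)

  pairAllowed? : ∀ a c → Dec (PairAllowed a c)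
  pairAllowed? a c = (_ ≟ _) ×-dec allowed? a _

  pairAllowed : ∀ {a b} → Allowed a b → PairAllowed a (combine (first a) b)
  pairAllowed {a} {b} ok = cong proj₁ eq , subst (Allowed a) (sym (cong proj₂ eq)) ok
    where eq = remQuot-combine (first a) b

  pair : Fin n → Fin (suc m * suc m)
  pair = Assignments.balanced PairAllowed pairAllowed? (λ _ → zero)

  pair-minimal : Assignments.EnergyMinimal PairAllowed pair
  pair-minimal = Assignments.balanced-minimal PairAllowed pairAllowed? _ {λ a → combine (first a) (first a)}
    (λ a → pairAllowed (proj₁ first-minimal a))

  second : Fin n → Fin (suc m)
  second a = remainder {suc m} (suc m) (pair a)

  pair≡ : ∀ a → pair a ≡ combine (first a) (second a)
  pair≡ a = trans (sym (combine-remQuot {suc m} (suc m) (pair a)))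
                  (cong (λ b → combine b (second a)) (proj₁ (proj₁ pair-minimal a)))

  second-edge : ∀ {a b} → Edge E₁ a b → Edge E₁ a (second a)
  second-edge e = allowed-edge e (proj₂ (proj₁ pair-minimal _))

  δ-combine : ∀ (b b′ c c′ : Fin (suc m)) → δ (combine b c) (combine b′ c′) ≡ δ b b′ * δ c c′
  δ-combine b b′ c c′ with combine b c ≟ combine b′ c′ | b ≟ b′ | c ≟ c′
  ... | yes _  | yes _  | yes _  = refl
  ... | no ≢   | yes refl | yes refl = contradiction refl ≢
  ... | no _   | no _   | _      = refl
  ... | no _   | yes _  | no _   = refl
  ... | yes eq | no ≢   | _      = contradiction (proj₁ (combine-injective b c b′ c′ eq)) ≢
  ... | yes eq | yes _  | no ≢   = contradiction (proj₂ (combine-injective b c b′ c′ eq)) ≢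

  -- Through this identity, balance of `pair` becomes balance of `second` inside every fibre of
  -- `first`.
  load-pair : ∀ b c → load pair (combine b c) ≡ fib (λ a → δ (first a) b) second c
  load-pair b c = sum-cong-≗ {n} (λ a →
    trans (cong (λ x → δ x (combine b c)) (pair≡ a)) (δ-combine (first a) b (second a) c))

  second-balanced : ∀ {a b} → Edge E₁ a b →
    fib (λ a′ → δ (first a′) (first a)) second (second a) ≤ fib (λ a′ → δ (first a′) (first a)) second b + 1
  second-balanced {a} {b} e = begin
    fib (λ a′ → δ (first a′) (first a)) second (second a)  ≡⟨ sym (load-pair (first a) (second a)) ⟩
    load pair (combine (first a) (second a))               ≡⟨ cong (load pair) (sym (pair≡ a)) ⟩
    load pair (pair a)
      ≤⟨ Assignments.edge-balanced PairAllowed {pair} pair-minimal {a} {combine (first a) b} (pairAllowed (inj₁ e)) ⟩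
    load pair (combine (first a) b) + 1                    ≡⟨ cong (_+ 1) (load-pair (first a) b) ⟩
    fib (λ a′ → δ (first a′) (first a)) second b + 1       ∎
    where open ≤-Reasoning

-- Encoding partial assignments as bit strings

-- Strong induction: halving with rounding up lowers the logarithm by one, and n is at most twice
-- the rounded half.
n≤2^⌈log₂n⌉ : ∀ n → n ≤ 2 ^ ⌈log₂ n ⌉
n≤2^⌈log₂n⌉ = <-rec _ go
  where
  go : ∀ n → (∀ {i} → i < n → i ≤ 2 ^ ⌈log₂ i ⌉) → n ≤ 2 ^ ⌈log₂ n ⌉
  go zero          rec = z≤n
  go (suc zero)    rec = ≤-refl
  go (suc (suc n)) rec = begin
    N                              ≡⟨ sym (⌊n/2⌋+⌈n/2⌉≡n N) ⟩
    ⌊ N /2⌋ + ⌈ N /2⌉              ≤⟨ +-monoˡ-≤ ⌈ N /2⌉ (⌊n/2⌋≤⌈n/2⌉ N) ⟩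
    ⌈ N /2⌉ + ⌈ N /2⌉              ≤⟨ +-mono-≤ half half ⟩
    2 ^ (L ∸ 1) + 2 ^ (L ∸ 1)      ≡⟨ cong (2 ^ (L ∸ 1) +_) (sym (+-identityʳ _)) ⟩
    2 ^ suc (L ∸ 1)                ≡⟨ cong (2 ^_) (m+[n∸m]≡n (⌈log₂⌉-mono-≤ {2} {N} (s≤s (s≤s z≤n)))) ⟩
    2 ^ L                          ∎
    where
    open ≤-Reasoning
    N = suc (suc n)
    L = ⌈log₂ N ⌉
    half : ⌈ N /2⌉ ≤ 2 ^ (L ∸ 1)
    half = subst (λ l → ⌈ N /2⌉ ≤ 2 ^ l) (⌈log₂⌈n/2⌉⌉≡⌈log₂n⌉∸1 N) (rec (⌈n/2⌉<n n))

-- One bit beyond the logarithm, since the alphabet has m + 1 ≤ 2m symbols: the m vertices and "no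
-- edge".
width : ℕ → ℕ
width m = suc (logCeil m)

suc-m≤2^width : ∀ m → 1 ≤ m → suc m ≤ 2 ^ width m
suc-m≤2^width m m≥1 = begin
  1 + m                                ≤⟨ +-monoˡ-≤ m m≥1 ⟩
  m + m                                ≤⟨ +-mono-≤ (n≤2^⌈log₂n⌉ m) (n≤2^⌈log₂n⌉ m) ⟩
  2 ^ logCeil m + 2 ^ logCeil m        ≡⟨ cong (2 ^ logCeil m +_) (sym (+-identityʳ _)) ⟩
  2 ^ width m                          ∎
  where open ≤-Reasoning

isZero : Fin 2 → Bool
isZero zero    = true
isZero (suc _) = false

isZero-injective : ∀ i j → isZero i ≡ isZero j → i ≡ j
isZero-injective zero       zero       _ = refl
isZero-injective (suc zero) (suc zero) _ = refl

funToFin-cong : (f g : Fin n → Fin m) → (∀ i → f i ≡ g i) → funToFin f ≡ funToFin g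
funToFin-cong {zero}  f g eq = refl
funToFin-cong {suc n} f g eq = cong₂ combine (eq zero) (funToFin-cong (f ∘ suc) (g ∘ suc) (eq ∘ suc))

nth : List Bool → ℕ → Bool
nth []       _       = false
nth (x ∷ xs) zero    = x
nth (x ∷ xs) (suc i) = nth xs i

nth-tabulate : (f : Fin n → Bool) (i : Fin n) → nth (tabulate f) (toℕ i) ≡ f i
nth-tabulate f zero    = refl
nth-tabulate f (suc i) = nth-tabulate (f ∘ suc) i

-- A symbol is zero for "no edge" and suc b for the vertex b.
module Encoding (m : ℕ) where

  M = suc m

  widen : Fin (suc M) → Fin (2 ^ width M)
  widen s = inject≤ s (suc-m≤2^width M (s≤s z≤n))

  bit : Fin (suc M) → Fin (width M) → Bool
  bit s l = isZero (finToFun (widen s) l)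

  bit-injective : ∀ s s′ → (∀ l → bit s l ≡ bit s′ l) → s ≡ s′
  bit-injective s s′ eq = inject≤-injective _ _ s s′ (begin
    widen s                                      ≡⟨ sym (funToFin-finToFin {width M} (widen s)) ⟩
    funToFin (finToFun {2} {width M} (widen s))
      ≡⟨ funToFin-cong {width M} _ _ (λ l → isZero-injective _ _ (eq l)) ⟩
    funToFin (finToFun {2} {width M} (widen s′)) ≡⟨ funToFin-finToFin {width M} (widen s′) ⟩
    widen s′                                     ∎)
    where open ≡-Reasoning

  encode : (Fin p → Fin (suc M)) → List Bool
  encode {p} s = tabulate {n = p * width M} (λ i → bit (s (quotient {p} (width M) i)) (remainder {p} (width M) i))

  length-encode : (s : Fin p → Fin (suc M)) → length (encode s) ≡ p * width M
  length-encode s = length-tabulate _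

  -- Decoding is a test instead of an inverse function: block `i` is compared with the code of each
  -- vertex. The block of the symbol `zero` passes for no `b`, by `bit-injective`.
  Received : List Bool → Fin p → Fin M → Set
  Received msg i b = ∀ l → nth msg (toℕ (combine i l)) ≡ bit (suc b) l

  received? : ∀ msg (i : Fin p) b → Dec (Received msg i b)
  received? msg i b = all? (λ l → nth msg (toℕ (combine i l)) Bool.≟ bit (suc b) l)

  nth-encode : (s : Fin p → Fin (suc M)) → ∀ i l → nth (encode s) (toℕ (combine i l)) ≡ bit (s i) l
  nth-encode {p} s i l = trans (nth-tabulate _ (combine i l))
    (cong (λ q → bit (s (proj₁ q)) (proj₂ q)) (remQuot-combine {p} {width M} i l))

  received-sound : (s : Fin p → Fin (suc M)) → ∀ {i b} → Received (encode s) i b → s i ≡ suc b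
  received-sound s {i} {b} rec = bit-injective (s i) (suc b) (λ l → trans (sym (nth-encode s i l)) (rec l))

  received-complete : (s : Fin p → Fin (suc M)) → ∀ {i b} → s i ≡ suc b → Received (encode s) i b
  received-complete s {i} eq l = trans (nth-encode s i l) (cong (λ x → bit x l) eq)

-- From assignments to protocols

Skeleton : ℕ → Set
Skeleton r = ∀ {n m} → EdgeSet n (suc m) → Fin r → Fin n → Fin (suc m)

-- The condition concerns vertices with an edge of E₁; for the others `symbol` sends `zero` in place
-- of the arbitrary value of the assignment.
PicksEdges : ∀ {r} → Skeleton r → Set
PicksEdges sk = ∀ {n m} (E₁ : EdgeSet n (suc m)) j {a b} → Edge E₁ a b → Edge E₁ a (sk E₁ j a)

module Protocol {r : ℕ} (sk : Skeleton r) (picks : PicksEdges sk) where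

  module _ {n m : ℕ} (E₁ : EdgeSet n (suc m)) where

    symbol : Fin (r * n) → Fin (suc (suc m))
    symbol i with any? (edge? E₁ (remainder {r} n i))
    ... | yes _ = suc (sk E₁ (quotient {r} n i) (remainder {r} n i))
    ... | no _  = zero

    symbol-sound : ∀ {i b} → symbol i ≡ suc b → Edge E₁ (remainder {r} n i) b
    symbol-sound {i} eq with any? (edge? E₁ (remainder {r} n i))
    symbol-sound {i} refl | yes (_ , e) = picks E₁ (quotient {r} n i) e

    symbol-complete : ∀ {j a b} → Edge E₁ a b → symbol (combine j a) ≡ suc (sk E₁ j a)
    symbol-complete {j} {a} {b} e with any? (edge? E₁ (remainder {r} n (combine j a)))
    ... | yes _   = cong (λ q → suc (sk E₁ (proj₁ q) (proj₂ q))) (remQuot-combine j a)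
    ... | no none = contradiction (b , subst (λ a′ → Edge E₁ a′ b) (sym (cong proj₂ (remQuot-combine j a))) e) none

  -- For m ≤ 1 the budget logCeil m is 0, but then G can only be the complete graph.
  message : (n m : ℕ) → EdgeSet n m → List Bool
  message n zero          E₁ = []
  message n (suc zero)    E₁ = []
  message n (suc (suc m)) E₁ = Encoding.encode (suc m) (symbol E₁)

  known : (n m : ℕ) → List Bool → EdgeSet n (suc m) → EdgeSet n (suc m)
  known n zero    msg E₂ a b = true
  known n (suc m) msg E₂ a b = E₂ a b ∨ does (any? (λ (j : Fin r) → Encoding.received? (suc m) msg (combine j a) b))

  assign : (n m : ℕ) → List Bool → EdgeSet n (suc m) → Fin n → Fin (suc m)
  assign n m msg E₂ = Assignments.balanced (Edge H) (edge? H) (λ _ → zero)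
    where H = known n m msg E₂

  output : (n m : ℕ) → List Bool → EdgeSet n m → EdgeSet n m
  output n zero    msg E₂ a ()
  output n (suc m) msg E₂ = graph (assign n m msg E₂)

  protocol : OneWayProtocol
  protocol = record { message = message ; output = output }

  module Run {n m : ℕ} (E₁ E₂ : EdgeSet n (suc m)) where

    H : EdgeSet n (suc m)
    H = known n m (message n (suc m) E₁) E₂

    F : Fin n → Fin (suc m)
    F = assign n m (message n (suc m) E₁) E₂

  E₂⊆known : ∀ {n m} (E₁ E₂ : EdgeSet n (suc m)) → E₂ ⊆E Run.H E₁ E₂
  E₂⊆known {m = zero}  E₁ E₂ a b e = refl
  E₂⊆known {m = suc m} E₁ E₂ a b e = cong (_∨ _) e

  skeleton⊆known : ∀ {n m} (E₁ E₂ : EdgeSet n (suc m)) j {a b} → Edge E₁ a b → Edge (Run.H E₁ E₂) a (sk E₁ j a)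
  skeleton⊆known {m = zero}  E₁ E₂ j e = refl
  skeleton⊆known {m = suc m} E₁ E₂ j {a} e = trans
    (cong (E₂ a _ ∨_) (dec-true (any? _)
      (j , Encoding.received-complete (suc m) (symbol E₁) (symbol-complete E₁ {j} e))))
    (Bool.∨-zeroʳ _)

  known⊆E : ∀ {n m} (E₁ E₂ : EdgeSet n (suc m)) → HasSemiMatching (E₁ ∪E E₂) → Run.H E₁ E₂ ⊆E (E₁ ∪E E₂)
  -- With a single vertex in B, the existence of a semi-matching forces every edge to be present.
  known⊆E {m = zero} E₁ E₂ (S , sm) a zero _ with SemiMatching.partner {E = E₁ ∪E E₂} sm a | SemiMatching.partner-edge {E = E₁ ∪E E₂} sm a
  ... | zero | e = e
  known⊆E {n} {suc m} E₁ E₂ _ a b e = [ (λ e₂ → trans (cong (E₁ a b ∨_) e₂) (Bool.∨-zeroʳ _)) , from-skeleton ]′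
    (∨-true (E₂ a b) _ e)
    where
    sent? : Dec (∃ λ (j : Fin r) → Encoding.Received (suc m) (message n (suc (suc m)) E₁) (combine j a) b)
    sent? = any? (λ j → Encoding.received? (suc m) (message n (suc (suc m)) E₁) (combine j a) b)
    from-skeleton : does sent? ≡ true → Edge (E₁ ∪E E₂) a b
    from-skeleton sent = let j , rec = does-true sent? sent in
      cong (_∨ E₂ a b) (subst (λ a′ → Edge E₁ a′ b) (cong proj₂ (remQuot-combine j a))
        (symbol-sound E₁ (Encoding.received-sound (suc m) (symbol E₁) rec)))

  length-message : ∀ n m (E₁ : EdgeSet n m) → length (message n m E₁) ≤ r * 2 * n * logCeil m
  length-message n zero          E₁ = z≤n
  length-message n (suc zero)    E₁ = z≤n
  length-message n (suc (suc m)) E₁ = begin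
    length (message n M E₁)         ≡⟨ Encoding.length-encode (suc m) (symbol E₁) ⟩
    -- As M ≥ 2, the logarithm is at least 1 and pays for the additional bit; this doubles the
    -- constant.
    r * n * (1 + logCeil M)         ≤⟨ *-monoʳ-≤ (r * n) (+-monoˡ-≤ (logCeil M) (⌈log₂⌉-mono-≤ {2} {M} (s≤s (s≤s z≤n)))) ⟩
    r * n * (logCeil M + logCeil M) ≡⟨ regroup r n (logCeil M) ⟩
    r * 2 * n * logCeil M           ∎
    where
    open ≤-Reasoning
    M = suc (suc m)
    regroup : ∀ r n l → r * n * (l + l) ≡ r * 2 * n * l
    regroup = solve-∀

  module _ (j₀ : Fin r) (Bound : ℕ → ℕ → ℕ → Set) (bound? : ∀ n D k → Dec (Bound n D k))
           (bound-0 : ∀ n k → Bound n 0 k)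
           (congested : ∀ {n m} (E₁ H : EdgeSet n (suc m)) → (∀ j {a b} → Edge E₁ a b → Edge H a (sk E₁ j a)) →
              ∀ {D k′} → 1 ≤ D → Congestion E₁ H (suc k′) (D + k′) → Bound n D (suc k′)) where

    F-minimal : ∀ {n m} (E₁ E₂ : EdgeSet n (suc m)) → HasSemiMatching (E₁ ∪E E₂) →
                Assignments.EnergyMinimal (Edge (Run.H E₁ E₂)) (Run.F E₁ E₂)
    F-minimal {n} {m} E₁ E₂ (S , sm) =
      Assignments.balanced-minimal (Edge H) (edge? H) _ {λ a → proj₁ (known-edge a)} (λ a → proj₂ (known-edge a))
      where
      open Run E₁ E₂
      open SemiMatching {E = E₁ ∪E E₂} sm
      known-edge : ∀ a → ∃ λ b → Edge H a b
      known-edge a with ∨-true (E₁ a (partner a)) _ (partner-edge a)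
      ... | inj₁ e₁ = sk E₁ j₀ a , skeleton⊆known E₁ E₂ j₀ e₁
      ... | inj₂ e₂ = partner a , E₂⊆known E₁ E₂ a (partner a) e₂

    solves : Solves protocol (λ n m → r * 2 * n * logCeil m) (λ n d k → Bound n (d ∸ 2 * k) k)
    solves zero zero E₁ E₂ _ _ = z≤n , ((λ ()) , λ ()) , λ S* _ → bound-0 0 (degMax S*)
    solves (suc n) zero E₁ E₂ _ (S , sm) = contradiction (proj₂ sm zero) λ ()
    solves n (suc m) E₁ E₂ _ has =
      length-message n (suc m) E₁ , (⊆E , degA-graph F) , λ S* opt → approx S* (proj₁ opt)
      where
      open Run E₁ E₂
      minimal = F-minimal E₁ E₂ has
      ⊆E : graph F ⊆E (E₁ ∪E E₂)
      ⊆E a b e = known⊆E E₁ E₂ has a b (subst (Edge H a) (does-true (F a ≟ b) e) (proj₁ minimal a))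
      approx : ∀ S* → IsSemiMatching (E₁ ∪E E₂) S* → Bound n (degMax (graph F) ∸ 2 * degMax S*) (degMax S*)
      approx S* sm* with degMax (graph F) ∸ 2 * degMax S* in eq
      ... | zero  = bound-0 n (degMax S*)
      ... | suc D = decidable-stable (bound? n (suc D) (degMax S*)) λ ¬bound →
        Congested.congestion {E₁ = E₁} {E₂} {H} (E₂⊆known E₁ E₂) sm* minimal (s≤s z≤n) large
          λ { (k′ , k≡ , cong′) → ¬bound (subst (Bound n (suc D)) (sym k≡)
                (congested E₁ H (skeleton⊆known E₁ E₂) (s≤s z≤n) cong′)) }
        where
        -- A nonzero truncated difference is a true difference.
        large : suc D + 2 * degMax S* ≤ degMax (graph F)
        large = ≤-reflexive (trans (cong (_+ 2 * degMax S*) (sym eq))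
          (m∸n+n≡m (<⇒≤ (m∸n≢0⇒n<m {degMax (graph F)} {2 * degMax S*} λ z → contradiction (trans (sym eq) z) λ ()))))

-- The two protocols and their approximation factors

one-skeleton : Skeleton 1
one-skeleton E₁ _ = Alice.first E₁

two-skeletons : Skeleton 2
two-skeletons E₁ zero    = Alice.first E₁
two-skeletons E₁ (suc _) = Alice.second E₁

one-picks : PicksEdges one-skeleton
one-picks E₁ _ = Alice.first-edge E₁

two-picks : PicksEdges two-skeletons
two-picks E₁ zero    = Alice.first-edge E₁
two-picks E₁ (suc _) = Alice.second-edge E₁

-- For a vertex `a` of X, Alice has sent the edge to `first a`, so `first a` is an H-neighbour of
-- `a` and lies in R. With y = D + k′ ≥ D this yields D² ≤ y² ≤ kn, and k ≤ k² because k is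
-- positive.
one-congested : (E₁ H : EdgeSet n (suc m)) → (∀ j {a b} → Edge E₁ a b → Edge H a (one-skeleton E₁ j a)) →
  ∀ {D k′} → 1 ≤ D → Congestion E₁ H (suc k′) (D + k′) → D ^ 2 ≤ n * suc k′ ^ 2
one-congested {n} E₁ H sent {D} {k′} D≥1 cong′ = begin
  D ^ 2                        ≤⟨ ^-monoˡ-≤ 2 (m≤m+n D k′) ⟩
  y ^ 2                        ≡⟨ cong (y *_) (*-identityʳ y) ⟩
  y * y                        ≤⟨ one-assignment-bound {y = y} {φ} {Alice.first E₁} {χ} {r} load≤k 1≤|r| (≤-trans D≥1 (m≤m+n D k′)) crowded
                                    (indicates-map (λ a (e , in-r) → in-r _ (sent zero e) , Alice.first-balanced E₁ e) confined) ⟩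
  suc k′ * n                   ≤⟨ *-monoˡ-≤ n (m≤m*n (suc k′) (suc k′)) ⟩
  suc k′ * suc k′ * n          ≡⟨ regroup (suc k′) n ⟩
  n * suc k′ ^ 2               ∎
  where
  open ≤-Reasoning
  open Congestion cong′
  y = D + k′
  regroup : ∀ k n → k * k * n ≡ n * (k * (k * 1))
  regroup = solve-∀

-- Both `first` and `second` map X into R, as both were sent. The bound 4k²n is relaxed to 8nk³, the
-- cube of 2n^{1/3}k.
two-congested : (E₁ H : EdgeSet n (suc m)) → (∀ j {a b} → Edge E₁ a b → Edge H a (two-skeletons E₁ j a)) →
  ∀ {D k′} → 1 ≤ D → Congestion E₁ H (suc k′) (D + k′) → D ^ 3 ≤ 8 * n * suc k′ ^ 3
two-congested {n} E₁ H sent {D} {k′} _ cong′ = begin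
  D ^ 3                        ≤⟨ ^-monoˡ-≤ 3 (m≤m+n D k′) ⟩
  y ^ 3                        ≡⟨ cong (λ x → y * (y * x)) (*-identityʳ y) ⟩
  y * (y * y)
    ≤⟨ two-assignments-bound {y = y} {φ} {Alice.first E₁} {Alice.second E₁} {χ} {r} load≤k (s≤s z≤n) 1≤|r| (m+n≤o⇒m≤o _ crowded)
         (indicates-map (λ a (e , in-r) → in-r _ (sent zero e) , Alice.first-balanced E₁ e) confined)
         (indicates-map (λ a (e , in-r) → in-r _ (sent (suc zero) e) , Alice.second-balanced E₁ e) confined) ⟩
  4 * (k * k) * n              ≤⟨ *-monoˡ-≤ n (*-mono-≤ (m≤m+n 4 4) (m≤m*n (k * k) k)) ⟩
  8 * (k * k * k) * n          ≡⟨ regroup k n ⟩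
  8 * n * k ^ 3                ∎
  where
  open ≤-Reasoning
  open Congestion cong′
  k = suc k′
  y = D + k′
  regroup : ∀ k n → 8 * (k * k * k) * n ≡ 8 * n * (k * (k * (k * 1)))
  regroup = solve-∀

theorem3 : ∃ λ (c : ℕ) →
    (Σ OneWayProtocol λ P → Solves P (λ n m → c * n * logCeil m) WithinSqrtFactor)
    × (Σ OneWayProtocol λ P → Solves P (λ n m → 2 * c * n * logCeil m) WithinCbrtFactor)
-- Sending r assignments costs at most 2rn · `logCeil m` bits: c = 2 for r = 1, and 2c = 4 for r =
-- 2.
theorem3 = 2
  , (Protocol.protocol one-skeleton one-picks
    , Protocol.solves one-skeleton one-picks zero (λ n D k → D ^ 2 ≤ n * k ^ 2)
        (λ n D k → _ ≤? _) (λ _ _ → z≤n) one-congested)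
  , (Protocol.protocol two-skeletons two-picks
    , Protocol.solves two-skeletons two-picks zero (λ n D k → D ^ 3 ≤ 8 * n * k ^ 3)
        (λ n D k → _ ≤? _) (λ _ _ → z≤n) two-congested)
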